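{- Let $x$ and $y$ be any notions of attack and let $P$ be an extended logic program. An argument of $P$ is provably $x/y$-justified if and only if it is $x/y$-justified.
   Context: Extended logic programs. An objective literal is an atom $B$ or its explicit negation $\neg B$; $\neg\neg L = L$. A default literal is $not~L$ with $L$ an objective literal. An extended logic program $P$ is a (possibly infinite) set of (ground) rules $L_0 \gets L_1,\dots,L_m, not~L_{m+1},\dots,not~L_{m+n}$ with $m,n\ge 0$ and all $L_i$ objective literals; $L_0$ is the head, the right-hand side is the body. Arguments. An argument for $P$ is a finite sequence $A=[r_1,\dots,r_n]$ of rules of $P$ such that for every $i$ and every objective literal $L$ in the body of $r_i$ there is $k>i$ with $head(r_k)=L$. A subargument of $A$ is a subsequence of $A$ that is an argument. Heads of rules of $A$ are its conclusions. $A$ is minimal for a conclusion $L$ if no proper subargument of $A$ has conclusion $L$; $A$ is minimal if it is minimal for some $L$. $\mathit{Args}_P$ is the set of minimal arguments for $P$; all arguments below range over $\mathit{Args}_P$. A notion of attack $x$ assigns to each program $P$ a binary relation $x_P\subseteq\mathit{Args}_P^2$ (written $x$ when $P$ is fixed). Justified arguments. For $S\subseteq \mathit{Args}_P$, $A$ is $x/y$-acceptable wrt. $S$ if for every argument $B$ with $(B,A)\in x$ there is $C\in S$ with $(C,B)\in y$. $A$ is $x/y$-justified if it belongs to $J_{x/y}$, the least fixpoint of the monotone operator $S\mapsto\{A\mid A\text{ is }x/y\text{ -acceptable wrt. }S\}$ on subsets of $\mathit{Args}_P$. Dialogues. The players are the proponent $\mathsf{P}$ and the opponent $\mathsf{O}$.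 An $x/y$-dialogue is a finite nonempty sequence of moves $move_i=(Player_i,Arg_i)$ ($i>0$) such that: (1) $Player_i=\mathsf{P}$ iff $i$ is odd, and $Player_i=\mathsf{O}$ iff $i$ is even; (2) if $Player_i=Player_j$ and $i\ne j$ then $Arg_i\neq Arg_j$; (3) if $Player_i=\mathsf{P}$ and $i>1$ then $Arg_i$ is a minimal argument with $(Arg_i,Arg_{i-1})\in y$; (4) if $Player_i=\mathsf{O}$ then $(Arg_i,Arg_{i-1})\in x$. An $x/y$-dialogue tree is a tree of moves such that every branch is an $x/y$-dialogue (in particular finite), and for every move $(\mathsf{P},Arg_i)$ in it, its children are all the moves $(\mathsf{O},Arg_j)$ with $(Arg_j,Arg_i)\in x$. A player wins a dialogue iff the other player, whose turn it is, cannot move (i.e. the dialogue cannot be extended); a player wins a dialogue tree iff it wins all branches. $A$ is provably $x/y$-justified iff there exists an $x/y$-dialogue tree with $A$ as the argument of its root, won by the proponent. -}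

module Defs where

open import Data.Fin using (Fin; toℕ) renaming (_<_ to _<ᶠ_)
open import Data.List using (List; []; _∷_; _∷ʳ_; length; lookup; applyUpTo)
open import Data.List.Membership.Propositional using () renaming (_∈_ to _∈ˡ_)
open import Data.List.NonEmpty using (List⁺; _∷_; _⁺∷ʳ_; toList; last)
open import Data.List.Relation.Binary.Sublist.Propositional using () renaming (_⊆_ to _⊑_)
open import Data.List.Relation.Unary.All using (All)
open import Data.Nat using (ℕ; suc; parity)
open import Data.Parity using (0ℙ; 1ℙ)
open import Data.Product using (∃; ∃-syntax; _×_; _,_)
open import Data.Refinement using (Refinement-syntax)
open import Function.Bundles using (_⇔_)
open import Level using (Level) renaming (suc to lsuc)
open import Relation.Binary using (Rel)
open import Relation.Binary.PropositionalEquality using (_≡_; _≢_; refl)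
open import Relation.Nullary using (¬_)
open import Relation.Unary using (Pred; _∈_; _⊆_; _≐_)

private
  variable
    ℓ s : Level

data ObjectiveLiteral (Atom : Set ℓ) : Set ℓ where
  pos neg : Atom → ObjectiveLiteral Atom

-- Explicit negation of a literal.
∼_ : {Atom : Set ℓ} → ObjectiveLiteral Atom → ObjectiveLiteral Atom
∼ pos b = neg b
∼ neg b = pos b

∼-involutive : {Atom : Set ℓ} (l : ObjectiveLiteral Atom) → ∼ (∼ l) ≡ l
∼-involutive (pos b) = refl
∼-involutive (neg b) = refl

data DefaultLiteral (Atom : Set ℓ) : Set ℓ where
  not_ : ObjectiveLiteral Atom → DefaultLiteral Atom

record Rule (Atom : Set ℓ) : Set ℓ where
  constructor _←_,_
  field
    head          : ObjectiveLiteral Atom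
    objectiveBody : List (ObjectiveLiteral Atom)
    defaultBody   : List (DefaultLiteral Atom)
open Rule public

-- A possibly infinite set of rules.
Program : Set ℓ → Set (lsuc ℓ)
Program {ℓ} Atom = Pred (Rule Atom) ℓ

module _ {Atom : Set ℓ} where

  record IsArgument (P : Program Atom) (A : List (Rule Atom)) : Set ℓ where
    field
      rules     : All (_∈ P) A
      supported : ∀ (i : Fin (length A)) (L : ObjectiveLiteral Atom) →
                  L ∈ˡ objectiveBody (lookup A i) →
                  ∃[ k ] i <ᶠ k × head (lookup A k) ≡ L

  IsSubargument : Program Atom → (B A : List (Rule Atom)) → Set ℓ
  IsSubargument P B A = B ⊑ A × IsArgument P B

  HasConclusion : List (Rule Atom) → ObjectiveLiteral Atom → Set ℓ
  HasConclusion A L = ∃[ r ] r ∈ˡ A × head r ≡ L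

  MinimalFor : Program Atom → List (Rule Atom) → ObjectiveLiteral Atom → Set ℓ
  MinimalFor P A L =
    HasConclusion A L ×
    (∀ B → IsSubargument P B A → B ≢ A → ¬ HasConclusion B L)

  IsMinimalArgument : Program Atom → List (Rule Atom) → Set ℓ
  IsMinimalArgument P A = IsArgument P A × ∃[ L ] MinimalFor P A L

  -- The membership proof is irrelevant, so two elements are equal exactly when
  -- they are the same sequence of rules.
  Args : Program Atom → Set ℓ
  Args P = [ A ∈ List (Rule Atom) ∣ IsMinimalArgument P A ]

NotionOfAttack : Set ℓ → Set (lsuc ℓ)
NotionOfAttack {ℓ} Atom = (P : Program Atom) → Rel (Args P) ℓ

data Player : Set where
  proponent opponent : Player

other : Player → Player
other proponent = opponent
other opponent  = proponent

record Move (Arg : Set ℓ) : Set ℓ where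
  constructor _,_
  field
    player : Player
    arg    : Arg
open Move public

-- A tree of moves, given by its root and by the sequences of moves leading from
-- the root to a node (the root itself is []).  Both infinite branching and
-- infinite branches are possible.
record MoveTree (Arg : Set ℓ) : Set (lsuc ℓ) where
  field
    root          : Move Arg
    Node          : Pred (List (Move Arg)) ℓ
    root-node     : Node []
    prefix-closed : ∀ ms m → Node (ms ∷ʳ m) → Node ms

  path : List (Move Arg) → List⁺ (Move Arg)
  path ms = root ∷ ms

  FiniteBranch : Pred (List (Move Arg)) ℓ
  FiniteBranch ms = Node ms × (∀ m → ¬ Node (ms ∷ʳ m))

  -- The infinite branch root, f 0, f 1, …
  InfiniteBranch : Pred (ℕ → Move Arg) ℓ
  InfiniteBranch f = ∀ n → Node (applyUpTo f n)
open MoveTree public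

-- (B , A) ∈ x is written x B A.
module _ {Arg : Set ℓ} (x y : Rel Arg ℓ) where

  Acceptable : Pred Arg s → Pred Arg _
  Acceptable S A = ∀ B → x B A → ∃[ C ] C ∈ S × y C B

  data Justified : Pred Arg ℓ where
    justified : ∀ {A} → A ∈ Acceptable Justified → A ∈ Justified

  Justified-fixpoint : Acceptable Justified ≐ Justified
  Justified-fixpoint = justified , λ { (justified acc) → acc }

  Justified-least : (S : Pred Arg s) → Acceptable S ⊆ S → Justified ⊆ S
  Justified-least S closed (justified acc) = closed λ B xBA →
    let (C , j , yCB) = acc B xBA in C , Justified-least S closed j , yCB

  -- The move with Fin-index i is the one numbered suc (toℕ i) when counting
  -- from 1.
  record IsDialogue (d : List⁺ (Move Arg)) : Set ℓ where
    move : Fin (length (toList d)) → Move Arg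
    move = lookup (toList d)

    field
      proponent-odd  : ∀ i → player (move i) ≡ proponent ⇔ parity (suc (toℕ i)) ≡ 1ℙ
      opponent-even  : ∀ i → player (move i) ≡ opponent ⇔ parity (suc (toℕ i)) ≡ 0ℙ
      no-repetition  : ∀ i j → player (move i) ≡ player (move j) → i ≢ j →
                       arg (move i) ≢ arg (move j)
      proponent-move : ∀ i j → toℕ j ≡ suc (toℕ i) → player (move j) ≡ proponent →
                       y (arg (move j)) (arg (move i))
      opponent-move  : ∀ i j → toℕ j ≡ suc (toℕ i) → player (move j) ≡ opponent →
                       x (arg (move j)) (arg (move i))

  record IsDialogueTree (T : MoveTree Arg) : Set ℓ where
    field
      branches-finite    : ∀ f → ¬ InfiniteBranch T f
      branches-dialogues : ∀ ms → FiniteBranch T ms → IsDialogue (path T ms)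
      all-attacks        : ∀ ms A → Node T ms → last (path T ms) ≡ (proponent , A) →
                           ∀ m → Node T (ms ∷ʳ m) ⇔
                                 (∃[ B ] m ≡ (opponent , B) × x B A)

  turn : List⁺ (Move Arg) → Player
  turn d = other (player (last d))

  Wins : Player → List⁺ (Move Arg) → Set ℓ
  Wins p d = turn d ≡ other p × (∀ m → ¬ IsDialogue (d ⁺∷ʳ m))

  WinsTree : Player → MoveTree Arg → Set ℓ
  WinsTree p T = ∀ ms → FiniteBranch T ms → Wins p (path T ms)

  ProvablyJustified : Pred Arg (lsuc ℓ)
  ProvablyJustified A =
    ∃[ T ] IsDialogueTree T × arg (root T) ≡ A × WinsTree proponent T

{-# OPTIONS --safe #-}

-- A won dialogue tree is well-founded, and recursion along it justifies every
-- argument the proponent plays, because the opponent plays all attackers and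
-- always receives a reply.
--
-- Conversely, a derivation of A ∈ Justified is a well-founded tree in which an
-- attacker of A is answered by the root of an immediate subderivation. Playing
-- these answers may repeat a move, so the proponent instead always chooses a
-- ⊏-minimal subderivation whose root answers the attacker. If an opponent's move
-- came back, its second answer would have a smaller derivation than the first,
-- and so would a proponent's move that came back; both contradict minimality.

module Submission where

open import Defs
open import Axiom.ExcludedMiddle using (ExcludedMiddle)
open import Data.Fin using (zero; suc; toℕ)
open import Data.List using (List; []; _∷_; _∷ʳ_; _++_; lookup; applyUpTo; initLast; _∷ʳ′_)
open import Data.List.Membership.Propositional.Properties using (∈-lookup)
open import Data.List.NonEmpty using (_∷_; toList; last)
open import Data.List.Properties using (++-assoc; ++-identityʳ; applyUpTo-∷ʳ)
open import Data.List.Relation.Unary.All as All using (All; []; _∷_)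
open import Data.List.Relation.Unary.AllPairs using (AllPairs; []; _∷_)
open import Data.List.Relation.Unary.Linked using (Linked; []; [-]; _∷_)
open import Data.Nat using (ℕ; zero; suc; _+_; parity)
import Data.Nat.Properties as ℕ
open import Data.Parity using (Parity; 0ℙ; 1ℙ; _⁻¹)
open import Data.Parity.Properties using (suc-homo-⁻¹; ⁻¹-selfInverse)
open import Data.Product using (∃; ∃-syntax; Σ; _×_; _,_; proj₁; proj₂)
open import Data.Unit.Polymorphic using (⊤; tt)
open import Function using (_∘_)
open import Function.Bundles using (_⇔_; mk⇔; Equivalence)
open import Function.Construct.Composition using (_⇔-∘_)
open import Induction.WellFounded using (WellFounded; Acc; acc)
open import Level using (Level)
open import Relation.Binary using (Rel; Symmetric)
open import Relation.Binary.Construct.Closure.Transitive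
  using (TransClosure; [_]; transitive; wellFounded)
open import Relation.Binary.PropositionalEquality
  using (_≡_; _≢_; refl; sym; trans; cong; subst)
open import Relation.Nullary using (¬_; Dec; yes; no; contradiction)
open import Relation.Nullary.Decidable using (recompute; decidable-stable)
open import Relation.Unary using (Pred; _∈_)

open Equivalence using (to; from)

private
  variable
    a r ℓ : Level
    A : Set a
    R : Rel A r

-- Consecutive and pairwise relations on lists.

last-∷ : (v w : A) (xs : List A) → last (v ∷ w ∷ xs) ≡ last (w ∷ xs)
last-∷ v w xs with initLast xs
... | []             = refl
... | ys ∷ʳ′ z = refl

last-∷ʳ : (v : A) (xs : List A) (w : A) → last (v ∷ (xs ∷ʳ w)) ≡ w
last-∷ʳ v []       w = refl
last-∷ʳ v (u ∷ xs) w = trans (last-∷ v u (xs ∷ʳ w)) (last-∷ʳ u xs w)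

Linked-lookup : ∀ {xs} → Linked R xs → ∀ i j → toℕ j ≡ suc (toℕ i) →
                R (lookup xs i) (lookup xs j)
Linked-lookup (Rvw ∷ _)  zero    (suc zero) _  = Rvw
Linked-lookup (_ ∷ Rxs)  (suc i) (suc j)    eq = Linked-lookup Rxs i j (ℕ.suc-injective eq)

Linked-tabulate : ∀ xs → (∀ i j → toℕ j ≡ suc (toℕ i) → R (lookup xs i) (lookup xs j)) →
                  Linked R xs
Linked-tabulate []           f = []
Linked-tabulate (v ∷ [])     f = [-]
Linked-tabulate (v ∷ w ∷ xs) f =
  f zero (suc zero) refl ∷
  Linked-tabulate (w ∷ xs) λ i j eq → f (suc i) (suc j) (cong suc eq)

Linked-++⁻ˡ : ∀ xs {ys} → Linked R (xs ++ ys) → Linked R xs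
Linked-++⁻ˡ []           Rxs         = []
Linked-++⁻ˡ (v ∷ [])     Rxs         = [-]
Linked-++⁻ˡ (v ∷ w ∷ xs) (Rvw ∷ Rxs) = Rvw ∷ Linked-++⁻ˡ (w ∷ xs) Rxs

Linked-last : ∀ (v : A) xs {w} → Linked R (v ∷ (xs ∷ʳ w)) → R (last (v ∷ xs)) w
Linked-last v []       (Rvw ∷ _) = Rvw
Linked-last {R = R} v (u ∷ xs) {w} (_ ∷ Rxs) =
  subst (λ l → R l w) (sym (last-∷ v u xs)) (Linked-last u xs Rxs)

AllPairs-lookup : Symmetric R → ∀ {xs} → AllPairs R xs → ∀ i j → i ≢ j →
                  R (lookup xs i) (lookup xs j)
AllPairs-lookup Rsym (Rx ∷ Rxs) zero    zero    i≢j = contradiction refl i≢j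
AllPairs-lookup Rsym (Rx ∷ Rxs) zero    (suc j) i≢j = All.lookup Rx (∈-lookup j)
AllPairs-lookup Rsym (Rx ∷ Rxs) (suc i) zero    i≢j = Rsym (All.lookup Rx (∈-lookup i))
AllPairs-lookup Rsym (Rx ∷ Rxs) (suc i) (suc j) i≢j =
  AllPairs-lookup Rsym Rxs i j (i≢j ∘ cong suc)

-- The parity of the numbers of a player's moves.
side : Player → Parity
side proponent = 1ℙ
side opponent  = 0ℙ

side-injective : ∀ {p q} → side p ≡ side q → p ≡ q
side-injective {proponent} {proponent} _ = refl
side-injective {opponent}  {opponent}  _ = refl

side-other : ∀ p → side (other p) ≡ side p ⁻¹
side-other proponent = refl
side-other opponent  = refl

parity-suc : ∀ n → parity (suc n) ≡ parity n ⁻¹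
parity-suc n = sym (⁻¹-selfInverse (suc-homo-⁻¹ n))

-- Dialogues as chains of local steps.

module _ {Arg : Set ℓ} where

  Distinct : Rel (Move Arg) ℓ
  Distinct m n = player m ≡ player n → arg m ≢ arg n

  Distinct-sym : Symmetric Distinct
  Distinct-sym d eq = d (sym eq) ∘ sym

module _ {Arg : Set ℓ} (x y : Rel Arg ℓ) where

  -- Bundles the alternation of turns with the attack conditions, so that all of `IsDialogue` except
  -- `no-repetition` becomes a condition on consecutive moves, given that the proponent opens.
  data Step : Rel (Move Arg) ℓ where
    attack : ∀ {A B} → x B A → Step (proponent , A) (opponent , B)
    reply  : ∀ {B C} → y C B → Step (opponent , B) (proponent , C)

  step : ∀ m n → player n ≡ other (player m) →
         (player n ≡ proponent → y (arg n) (arg m)) →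
         (player n ≡ opponent → x (arg n) (arg m)) → Step m n
  step (proponent , A) (.opponent , B)  refl _ x′ = attack (x′ refl)
  step (opponent , B)  (.proponent , C) refl y′ _ = reply (y′ refl)

  step-other : ∀ {m n} → Step m n → player n ≡ other (player m)
  step-other (attack _) = refl
  step-other (reply _)  = refl

  step-proponent : ∀ {m n} → Step m n → player n ≡ proponent → y (arg n) (arg m)
  step-proponent (reply yCB) _ = yCB

  step-opponent : ∀ {m n} → Step m n → player n ≡ opponent → x (arg n) (arg m)
  step-opponent (attack xBA) _ = xBA

  step-side : ∀ {m n} → Step m n → side (player n) ≡ side (player m) ⁻¹
  step-side {m} s = trans (cong side (step-other s)) (side-other (player m))

  -- `k` is the number of the first move; it stays variable because the induction shifts it by one
  -- at each tail.
  Linked-side : ∀ {m ms} k → Linked Step (m ∷ ms) → side (player m) ≡ parity k →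
                ∀ i → side (player (lookup (m ∷ ms) i)) ≡ parity (toℕ i + k)
  Linked-side k _        eq zero    = eq
  Linked-side k (s ∷ ss) eq (suc i) =
    trans (Linked-side (suc k) ss (trans (step-side s) (trans (cong _⁻¹ eq) (sym (parity-suc k)))) i)
          (cong parity (ℕ.+-suc (toℕ i) k))

  linked⇒dialogue : ∀ A ms → Linked Step ((proponent , A) ∷ ms) →
                    AllPairs Distinct ((proponent , A) ∷ ms) →
                    IsDialogue x y ((proponent , A) ∷ ms)
  linked⇒dialogue A ms steps distinct = record
    { proponent-odd  = owner proponent
    ; opponent-even  = owner opponent
    ; no-repetition  = λ i j eq i≢j → AllPairs-lookup Distinct-sym distinct i j i≢j eq
    ; proponent-move = λ i j eq → step-proponent (Linked-lookup steps i j eq)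
    ; opponent-move  = λ i j eq → step-opponent (Linked-lookup steps i j eq)
    }
    where
    d : List (Move Arg)
    d = (proponent , A) ∷ ms

    side≡ : ∀ i → side (player (lookup d i)) ≡ parity (suc (toℕ i))
    side≡ i = trans (Linked-side 1 steps refl i) (cong parity (ℕ.+-comm (toℕ i) 1))

    owner : ∀ p i → player (lookup d i) ≡ p ⇔ parity (suc (toℕ i)) ≡ side p
    owner p i = mk⇔ (λ eq → trans (sym (side≡ i)) (cong side eq))
                    (λ eq → side-injective (trans (side≡ i) eq))

  dialogue⇒linked : ∀ d → IsDialogue x y d → Linked Step (toList d)
  dialogue⇒linked d dialogue = Linked-tabulate (toList d) λ i j eq →
    step (move i) (move j)
         -- Consecutive numbers have opposite parities, and the parity determines the player.
         (side-injective (trans (side≡ j)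
           (trans (cong (parity ∘ suc) eq)
             (trans (parity-suc (suc (toℕ i)))
               (trans (cong _⁻¹ (sym (side≡ i))) (sym (side-other (player (move i)))))))))
         (proponent-move i j eq) (opponent-move i j eq)
    where
    open IsDialogue dialogue

    side≡ : ∀ i → side (player (move i)) ≡ parity (suc (toℕ i))
    side≡ i with player (move i) in eq
    ... | proponent = sym (to (proponent-odd i) eq)
    ... | opponent  = sym (to (opponent-even i) eq)

-- Excluded middle tells whether a smaller witness exists; accessibility ends the descent.
minimal : ExcludedMiddle ℓ → {A : Set ℓ} {_<_ : Rel A ℓ} (Q : Pred A ℓ) →
          ∀ {v} → Acc _<_ v → Q v → ∃[ w ] Q w × (∀ u → u < w → ¬ Q u)
minimal em {_<_ = _<_} Q {v} (acc rs) Qv with em {∃[ u ] u < v × Q u}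
... | yes (u , u<v , Qu) = minimal em Q (rs u<v) Qu
... | no ¬below          = v , Qv , λ u u<v Qu → ¬below (u , u<v , Qu)

-- From won dialogue trees to justification.

module WonTree (em : ExcludedMiddle ℓ) {Arg : Set ℓ} (x y : Rel Arg ℓ) (T : MoveTree Arg)
               (tree : IsDialogueTree x y T) (won : WinsTree x y proponent T) where

  open IsDialogueTree tree

  Extends : Rel (List (Move Arg)) ℓ
  Extends ns ms = Node T ns × ∃[ m ] ns ≡ ms ∷ʳ m

  Inaccessible : Set ℓ
  Inaccessible = ∃[ ms ] Node T ms × ¬ Acc Extends ms

  -- If every child were accessible, the node would be too. Excluded middle returns an actual move,
  -- so the choice can be iterated.
  inaccessible-child : ((ms , _) : Inaccessible) →
                       ∃[ m ] Node T (ms ∷ʳ m) × ¬ Acc Extends (ms ∷ʳ m)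
  inaccessible-child (ms , _ , ¬acc)
    with em {∃[ m ] Node T (ms ∷ʳ m) × ¬ Acc Extends (ms ∷ʳ m)}
  ... | yes child = child
  ... | no ¬child = contradiction
    (acc λ { (node , m , refl) → decidable-stable em λ ¬acc′ → ¬child (m , node , ¬acc′) }) ¬acc

  -- Otherwise iterating `inaccessible-child` from the root spells out an infinite branch, against
  -- `branches-finite`.
  accessible : Acc Extends []
  accessible = decidable-stable em λ ¬acc →
    branches-finite (moves ¬acc) λ n →
      subst (Node T) (spells ¬acc n) (proj₁ (proj₂ (states ¬acc n)))
    where
    module _ (¬acc : ¬ Acc Extends []) where

      states : ℕ → Inaccessible
      states zero    = [] , root-node T , ¬acc
      states (suc n) = let (m , child) = inaccessible-child (states n)
                       in proj₁ (states n) ∷ʳ m , child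

      moves : ℕ → Move Arg
      moves n = proj₁ (inaccessible-child (states n))

      spells : ∀ n → proj₁ (states n) ≡ applyUpTo moves n
      spells zero    = refl
      spells (suc n) = trans (cong (_∷ʳ moves n) (spells n)) (applyUpTo-∷ʳ moves n)

  -- The dialogue conditions are imposed on complete branches only; extending a node to a leaf makes
  -- them available at every node.
  finite-branch : ∀ ms → Acc Extends ms → Node T ms → ∃[ ns ] FiniteBranch T (ms ++ ns)
  finite-branch ms (acc rs) node with em {∃[ m ] Node T (ms ∷ʳ m)}
  ... | no ¬child = [] , subst (FiniteBranch T) (sym (++-identityʳ ms))
                               (node , λ m child → ¬child (m , child))
  ... | yes (m , child) =
    let (ns , finite) = finite-branch (ms ∷ʳ m) (rs (child , m , refl)) child
    in m ∷ ns , subst (FiniteBranch T) (++-assoc ms (m ∷ []) ns) finite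

  path-linked : ∀ ms → Acc Extends ms → Node T ms → Linked (Step x y) (root T ∷ ms)
  path-linked ms access node =
    let (ns , finite) = finite-branch ms access node
    in Linked-++⁻ˡ (root T ∷ ms)
         (dialogue⇒linked x y (root T ∷ (ms ++ ns)) (branches-dialogues (ms ++ ns) finite))

  root-proponent : player (root T) ≡ proponent
  root-proponent =
    let (ns , finite) = finite-branch [] accessible (root-node T)
    in from (IsDialogue.proponent-odd (branches-dialogues ns finite) zero) refl

  last-justified : ∀ ms A → Acc Extends ms → Node T ms →
                   last (path T ms) ≡ (proponent , A) → A ∈ Justified x y
  last-justified ms A (acc rs) node last≡ = justified respond
    where
    respond : A ∈ Acceptable x y (Justified x y)
    -- The recursive call lies two levels down, at a reply to `B`, so accessibility is unfolded
    -- twice.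
    respond B xBA = extend (rs (attacked , _ , refl)) (em {∃[ m ] Node T (ms′ ∷ʳ m)})
      where
      ms′ : List (Move Arg)
      ms′ = ms ∷ʳ (opponent , B)

      attacked : Node T ms′
      attacked = from (all-attacks ms A node last≡ (opponent , B)) (B , refl , xBA)

      last≡′ : last (path T ms′) ≡ (opponent , B)
      last≡′ = last-∷ʳ (root T) ms (opponent , B)

      replied : ∀ {m} → Acc Extends (ms′ ∷ʳ m) → Node T (ms′ ∷ʳ m) →
                Step x y (opponent , B) m → ∃[ C ] C ∈ Justified x y × y C B
      replied access child (reply {C = C} yCB) =
        C , last-justified _ C access child (last-∷ʳ (root T) ms′ _) , yCB

      extend : Acc Extends ms′ → Dec (∃[ m ] Node T (ms′ ∷ʳ m)) →
               ∃[ C ] C ∈ Justified x y × y C B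
      extend (acc rs′) (yes (m , child)) = replied (rs′ (child , m , refl)) child
        (subst (λ l → Step x y l m) last≡′
          (Linked-last (root T) ms′ (path-linked _ (rs′ (child , m , refl)) child)))
      -- A leaf here would leave the proponent to move, but on a won branch the turn is the
      -- opponent's.
      extend _ (no ¬child) with () ←
        trans (sym (cong (other ∘ player) last≡′))
              (proj₁ (won ms′ (attacked , λ m child → ¬child (m , child))))

  root-justified : arg (root T) ∈ Justified x y
  root-justified = last-justified [] _ accessible (root-node T) (cong (_, arg (root T)) root-proponent)

-- From justification to won dialogue trees.

module Strategy (em : ExcludedMiddle ℓ) {Arg : Set ℓ} (x y : Rel Arg ℓ) where

  Derivation : Set ℓ
  Derivation = ∃ (Justified x y)

  data _◁_ : Rel Derivation ℓ where
    sub : ∀ {A} {f : A ∈ Acceptable x y (Justified x y)} B (xBA : x B A) →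
          (let (C , j , _) = f B xBA) → (C , j) ◁ (A , justified f)

  ◁-wellFounded : WellFounded _◁_
  ◁-wellFounded (A , j) = go j
    where
    go : ∀ {A} (j : A ∈ Justified x y) → Acc _◁_ (A , j)
    go (justified f) = acc λ { (sub B xBA) → go (proj₁ (proj₂ (f B xBA))) }

  _⊏_ : Rel Derivation ℓ
  _⊏_ = TransClosure _◁_

  ⊏-trans : ∀ {s t u} → s ⊏ t → t ⊏ u → s ⊏ u
  ⊏-trans = transitive _◁_

  ⊏-wellFounded : WellFounded _⊏_
  ⊏-wellFounded = wellFounded _◁_ ◁-wellFounded

  -- A derivation may contain another derivation of its own conclusion; excluding this keeps the
  -- proponent from repeating the move.
  Shortest : Pred Derivation ℓ
  Shortest s = ∀ t → t ⊏ s → proj₁ t ≢ proj₁ s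

  Answers : Derivation → Arg → Pred Derivation ℓ
  Answers s B t = t ⊏ s × y (proj₁ t) B

  immediate-answer : ∀ s B → x B (proj₁ s) → ∃ (Answers s B)
  immediate-answer (A , justified f) B xBA =
    let (C , j , yCB) = f B xBA in (C , j) , [ sub B xBA ] , yCB

  -- The attack is an irrelevant argument, so that the answer depends on the
  -- attacker only; otherwise different nodes of an infinite branch could rest on
  -- incompatible choices of subderivations.
  best-answer : ∀ s B → .(x B (proj₁ s)) →
                ∃[ t ] Answers s B t × (∀ u → u ⊏ t → ¬ Answers s B u)
  best-answer s B xBA = minimal em (Answers s B) (⊏-wellFounded _)
                          (proj₂ (immediate-answer s B (recompute em xBA)))

  answer : ∀ s B → .(x B (proj₁ s)) → Derivation
  answer s B xBA = proj₁ (best-answer s B xBA)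

  module _ (s : Derivation) (B : Arg) .(xBA : x B (proj₁ s)) where

    answer-⊏ : answer s B xBA ⊏ s
    answer-⊏ = proj₁ (proj₁ (proj₂ (best-answer s B xBA)))

    answer-attacks : y (proj₁ (answer s B xBA)) B
    answer-attacks = proj₂ (proj₁ (proj₂ (best-answer s B xBA)))

    -- The choice is minimal only among subderivations of `s`, but by transitivity these include all
    -- subderivations of the answer.
    answer-minimal : ∀ u → u ⊏ answer s B xBA → ¬ y (proj₁ u) B
    answer-minimal u u⊏ yuB =
      proj₂ (proj₂ (best-answer s B xBA)) u u⊏ (⊏-trans u⊏ answer-⊏ , yuB)

    -- A smaller derivation of the same argument would attack `B` as well.
    answer-shortest : Shortest (answer s B xBA)
    answer-shortest u u⊏ eq = answer-minimal u u⊏ (subst (λ C → y C B) (sym eq) answer-attacks)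

  move : Derivation → Move Arg
  move s = proponent , proj₁ s

  mutual
    -- The move sequences that can follow the proponent's move of proj₁ s.
    Play : Derivation → Pred (List (Move Arg)) ℓ
    Play s []       = ⊤
    Play s (m ∷ ms) = player m ≡ opponent ×
                      Σ (x (arg m) (proj₁ s)) λ p → Answered (answer s (arg m) p) ms

    Answered : Derivation → Pred (List (Move Arg)) ℓ
    Answered t []       = ⊤
    Answered t (m ∷ ms) = m ≡ move t × Play t ms

  mutual
    Play-prefix : ∀ s ms {m} → Play s (ms ∷ʳ m) → Play s ms
    Play-prefix s []       _             = tt
    Play-prefix s (n ∷ ms) (eq , p , pl) = eq , p , Answered-prefix _ ms pl

    Answered-prefix : ∀ t ms {m} → Answered t (ms ∷ʳ m) → Answered t ms
    Answered-prefix t []       _         = tt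
    Answered-prefix t (n ∷ ms) (eq , pl) = eq , Play-prefix t ms pl

  -- Every two moves pass to a proper subderivation.
  Play-finite : ∀ {s} → Acc _⊏_ s → ∀ f → ¬ (∀ n → Play s (applyUpTo f n))
  Play-finite {s} (acc rs) f plays =
    let (_ , p , _) = plays 1
    in Play-finite (rs (answer-⊏ s (arg (f 0)) p)) (λ n → f (suc (suc n)))
         -- Each play carries its own proof of the attack; all continue from the same answer because
         -- `answer` ignores that proof.
         λ n → proj₂ (proj₂ (proj₂ (plays (suc (suc n)))))

  Play-linked : ∀ s ms → Play s ms → Linked (Step x y) (move s ∷ ms)
  Play-linked s []                  _                             = [-]
  Play-linked s ((_ , B) ∷ [])      (refl , p , _)                = attack p ∷ [-]
  Play-linked s ((_ , B) ∷ _ ∷ ms)  (refl , p , refl , pl)        =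
    attack p ∷ reply (answer-attacks s B p) ∷ Play-linked (answer s B p) ms pl

  Fits : Derivation → Pred (Move Arg) ℓ
  Fits t (proponent , C) = proj₁ t ≡ C
  Fits t (opponent , B)  = y (proj₁ t) B

  -- A proponent's move is tied to its own derivation, an opponent's move to its answer; every
  -- answer descends from `s`.
  Play-fits : ∀ s ms → Play s ms → All (λ m → ∃[ t ] t ⊏ s × Fits t m) ms
  Play-fits s []                 _                      = []
  -- The answer to a final attack serves as witness although it is not played.
  Play-fits s ((_ , B) ∷ [])     (refl , p , _)         =
    (_ , answer-⊏ s B p , answer-attacks s B p) ∷ []
  Play-fits s ((_ , B) ∷ _ ∷ ms) (refl , p , refl , pl) =
    (_ , answer-⊏ s B p , answer-attacks s B p) ∷
    (_ , answer-⊏ s B p , refl) ∷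
    All.map (λ (t , t⊏ , fits) → t , ⊏-trans t⊏ (answer-⊏ s B p) , fits)
            (Play-fits (answer s B p) ms pl)

  -- The hypothesis `Shortest` survives the induction, since `answer-shortest` restores it at every
  -- answer.
  Play-distinct : ∀ s ms → Shortest s → Play s ms → AllPairs Distinct (move s ∷ ms)
  Play-distinct s ms shortest play = All.map fresh (Play-fits s ms play) ∷ rest ms play
    where
    fresh : ∀ {m} → (∃[ t ] t ⊏ s × Fits t m) → Distinct (move s) m
    fresh {proponent , C} (t , t⊏s , t≡C) _ s≡C = shortest t t⊏s (trans t≡C (sym s≡C))

    rest : ∀ ms → Play s ms → AllPairs Distinct ms
    rest []                 _                      = []
    rest ((_ , B) ∷ [])     _                      = [] ∷ []
    rest ((_ , B) ∷ _ ∷ ms) (refl , p , refl , pl) =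
      ((λ ()) ∷ All.map freshᴼ (Play-fits (answer s B p) ms pl)) ∷
      Play-distinct (answer s B p) ms (answer-shortest s B p) pl
      where
      freshᴼ : ∀ {m} → (∃[ t ] t ⊏ answer s B p × Fits t m) → Distinct (opponent , B) m
      freshᴼ {opponent , _} (t , t⊏ , ytB) _ refl = answer-minimal s B p t t⊏ ytB

  -- Records what may follow a node: exactly the attackers after the proponent, at least one reply
  -- after the opponent. The node predicate and the root are parameters so that `Ending-∷` can pass
  -- from a subtree to the whole tree.
  data Ending (N : Pred (List (Move Arg)) ℓ) (r : Move Arg) (ms : List (Move Arg)) : Set ℓ where
    proponent-last : ∀ A → last (r ∷ ms) ≡ (proponent , A) →
                     (∀ m → N (ms ∷ʳ m) ⇔ (∃[ B ] m ≡ (opponent , B) × x B A)) → Ending N r ms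
    opponent-last  : ∀ B → last (r ∷ ms) ≡ (opponent , B) →
                     ∃[ m ] N (ms ∷ʳ m) → Ending N r ms

  Ending-∷ : ∀ {N N′ r m ms} → (∀ ns → N′ (m ∷ ns) ⇔ N ns) → Ending N m ms → Ending N′ r (m ∷ ms)
  Ending-∷ {r = r} {m} {ms} equiv (proponent-last A last≡ attacks) =
    proponent-last A (trans (last-∷ r m ms) last≡) λ n → attacks n ⇔-∘ equiv (ms ∷ʳ n)
  Ending-∷ {r = r} {m} {ms} equiv (opponent-last B last≡ (n , node)) =
    opponent-last B (trans (last-∷ r m ms) last≡) (n , from (equiv (ms ∷ʳ n)) node)

  mutual
    Play-ending : ∀ s ms → Play s ms → Ending (Play s) (move s) ms
    Play-ending s []             _               = proponent-last (proj₁ s) refl λ m → mk⇔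
      (λ { (refl , p , _) → arg m , refl , p })
      (λ { (B , refl , p) → refl , p , tt })
    Play-ending s ((_ , B) ∷ ms) (refl , p , pl) =
      Ending-∷ (λ ns → mk⇔ (λ (_ , _ , pl′) → pl′) (λ pl′ → refl , p , pl′))
               (Answered-ending B (answer s B p) ms pl)

    Answered-ending : ∀ B t ms → Answered t ms → Ending (Answered t) (opponent , B) ms
    Answered-ending B t []       _           = opponent-last B refl (move t , refl , tt)
    Answered-ending B t (_ ∷ ms) (refl , pl) =
      Ending-∷ (λ ns → mk⇔ proj₂ (refl ,_)) (Play-ending t ms pl)

  Play-tree : Derivation → MoveTree Arg
  Play-tree s = record
    { root          = move s
    ; Node          = Play s
    ; root-node     = tt
    ; prefix-closed = λ ms m → Play-prefix s ms
    }

  module _ (s : Derivation) where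

    Play-attacks : ∀ ms A → Play s ms → last (move s ∷ ms) ≡ (proponent , A) →
                   ∀ m → Play s (ms ∷ʳ m) ⇔ (∃[ B ] m ≡ (opponent , B) × x B A)
    Play-attacks ms A play last≡ with Play-ending s ms play
    ... | proponent-last A′ last≡′ attacks with refl ← trans (sym last≡) last≡′ = attacks
    ... | opponent-last B last≡′ _ with () ← trans (sym last≡) last≡′

    Play-isDialogueTree : Shortest s → IsDialogueTree x y (Play-tree s)
    Play-isDialogueTree shortest = record
      { branches-finite    = Play-finite (⊏-wellFounded s)
      ; branches-dialogues = λ ms (play , _) →
          linked⇒dialogue x y _ ms (Play-linked s ms play) (Play-distinct s ms shortest play)
      ; all-attacks        = Play-attacks
      }

    Play-won : WinsTree x y proponent (Play-tree s)
    Play-won ms (play , finite) with Play-ending s ms play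
    ... | opponent-last _ _ (m , child)    = contradiction child (finite m)
    -- A move extending the dialogue would be an attack on `A`, hence a child of this leaf.
    ... | proponent-last A last≡ attacks = cong (other ∘ player) last≡ , λ m dialogue →
      unanswered m (subst (λ l → Step x y l m) last≡
        (Linked-last (move s) ms (dialogue⇒linked x y _ dialogue)))
      where
      unanswered : ∀ m → ¬ Step x y (proponent , A) m
      unanswered m (attack xBA) = finite m (from (attacks m) (_ , refl , xBA))

  provably-justified : ∀ {A} → A ∈ Justified x y → A ∈ ProvablyJustified x y
  provably-justified {A} j =
    -- The given derivation need not be `Shortest`, so a minimal derivation of `A` replaces it.
    let (s , s≡A , least) = minimal em (λ t → proj₁ t ≡ A) (⊏-wellFounded (A , j)) refl
    in Play-tree s ,
       Play-isDialogueTree s (λ t t⊏s eq → least t t⊏s (trans eq s≡A)) ,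
       s≡A , Play-won s

theorem13 : ∀ {ℓ} → ExcludedMiddle ℓ →
    {Atom : Set ℓ} (x y : NotionOfAttack Atom) (P : Program Atom) (A : Args P) →
    ProvablyJustified (x P) (y P) A ⇔ Justified (x P) (y P) A
theorem13 em x y P A = mk⇔
  (λ { (T , tree , refl , won) → WonTree.root-justified em (x P) (y P) T tree won })
  (Strategy.provably-justified em (x P) (y P))
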